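{- Let $G=(V,E,\omega)$ be a finite directed non-negatively weighted graph, $r\in V$ a root and $k\ge 1$ an integer. Algorithm Exh-S-kSSP (described in the context), run on input $(G,r,k)$, computes all simple paths from $r$ to any other vertex; that is, every simple path from $r$ to any vertex of $V\setminus\{r\}$ is dequeued from the priority queue at some point of the execution.
   Context: $G=(V,E,\omega)$ is a finite directed graph, $E\subseteq V\times V$, with non-negative real edge weights $\omega$; $N^+(v)=\{u:(v,u)\in E\}$. A path from $s$ to $t$ is a vertex sequence $P=(s=v_1,\dots,v_\eta=t)$, $\eta\ge 1$, with $(v_i,v_{i+1})\in E$ for all $i<\eta$; $V(P)$ is its vertex set; it is simple if it has no repeated vertex; its weight is $\omega(P)=\sum_{i=1}^{\eta-1}\omega(v_i,v_{i+1})$. For a path $\Pi$ ending at $v$ and an edge $(v,u)$, $\Pi\oplus(u)$ is $\Pi$ extended by $u$. Algorithm Exh-S-kSSP. Maintain a list $T_v$ for each $v\in V$ (initially empty) and a min-priority queue $PQ$ of paths keyed by weight, initially containing only the trivial path $(r)$ with key $0$. While $PQ\ne\emptyset$: remove (dequeue) from $PQ$ a path $\Pi=(r,\dots,v)$ of minimum weight; for each $u\in N^+(v)\setminus V(\Pi)$ insert $\Pi\oplus(u)$ into $PQ$ with key $\omega(\Pi)+\omega(v,u)$; if $|T_v|<k$, add $\Pi$ to $T_v$. -}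

module Defs where

open import Data.Bool using (Bool; T)
open import Data.Bool.Properties using (T?)
open import Data.Empty using (⊥)
open import Data.Fin using (Fin)
open import Data.Fin.Properties using (_≟_)
open import Data.List using (List; []; [_]; _++_; _∷ʳ_; length; mapMaybe; allFin)
open import Data.List.Membership.Propositional using (_∈_)
open import Data.List.Relation.Unary.Any using (_─_)
open import Data.List.Relation.Unary.Unique.Propositional using (Unique)
open import Data.Maybe using (Maybe; just; nothing)
open import Data.Nat as ℕ using (ℕ; suc)
import Data.Nat.Properties as ℕ
open import Data.Product using (Σ; ∃; _,_)
open import Data.Rational as ℚ using (ℚ; 0ℚ; ½; _-_; ∣_∣)
import Data.Rational.Properties as ℚ
import Data.Rational.Solver as ℚ
open import Relation.Binary.PropositionalEquality using (_≡_; refl; sym; trans; subst)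
open import Relation.Nullary using (yes; no)

import Data.List.Membership.DecPropositional as DecMembership

-- Real numbers: Cauchy sequences of rationals.  Equality of reals would be
-- x ≤ y × y ≤ x; it is not needed below.

record ℝ : Set where
  constructor mkℝ
  field
    seq    : ℕ → ℚ
    cauchy : ∀ ε → 0ℚ ℚ.< ε →
             ∃ λ N → ∀ m n → N ℕ.≤ m → N ℕ.≤ n → ∣ seq m - seq n ∣ ℚ.< ε

open ℝ public

infix 4 _≤ℝ_
_≤ℝ_ : ℝ → ℝ → Set
x ≤ℝ y = ∀ ε → 0ℚ ℚ.< ε → ∃ λ N → ∀ n → N ℕ.≤ n → seq x n ℚ.≤ seq y n ℚ.+ ε

0ℝ : ℝ
0ℝ = mkℝ (λ _ → 0ℚ) (λ ε 0<ε → 0 , λ _ _ _ _ → 0<ε)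

private
  0<½* : ∀ ε → 0ℚ ℚ.< ε → 0ℚ ℚ.< ½ ℚ.* ε
  0<½* ε 0<ε = ℚ.positive⁻¹ (½ ℚ.* ε) {{ℚ.pos*pos⇒pos ½ ε {{ℚ.positive 0<ε}}}}

  halves : ∀ ε → ½ ℚ.* ε ℚ.+ ½ ℚ.* ε ≡ ε
  halves ε = trans (sym (ℚ.*-distribʳ-+ ε ½ ½)) (ℚ.*-identityˡ ε)

  interchange : ∀ a b c d → (a ℚ.+ b) - (c ℚ.+ d) ≡ (a - c) ℚ.+ (b - d)
  interchange = solve 4 (λ a b c d → (a :+ b) :- (c :+ d) := (a :- c) :+ (b :- d)) refl
    where open ℚ.+-*-Solver

  +-close : ∀ a b c d ε → ∣ a - c ∣ ℚ.< ½ ℚ.* ε → ∣ b - d ∣ ℚ.< ½ ℚ.* ε →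
            ∣ (a ℚ.+ b) - (c ℚ.+ d) ∣ ℚ.< ε
  +-close a b c d ε p q = subst (∣ (a ℚ.+ b) - (c ℚ.+ d) ∣ ℚ.<_) (halves ε)
    (ℚ.≤-<-trans
      (subst (λ z → ∣ z ∣ ℚ.≤ ∣ a - c ∣ ℚ.+ ∣ b - d ∣) (sym (interchange a b c d))
             (ℚ.∣p+q∣≤∣p∣+∣q∣ (a - c) (b - d)))
      (ℚ.+-mono-< p q))

infixl 6 _+ℝ_
_+ℝ_ : ℝ → ℝ → ℝ
seq (x +ℝ y) n = seq x n ℚ.+ seq y n
cauchy (x +ℝ y) ε 0<ε with cauchy x (½ ℚ.* ε) (0<½* ε 0<ε) | cauchy y (½ ℚ.* ε) (0<½* ε 0<ε)
... | M , p | N , q = M ℕ.⊔ N , λ m n m≥ n≥ →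
  +-close (seq x m) (seq y m) (seq x n) (seq y n) ε
    (p m n (ℕ.m⊔n≤o⇒m≤o M N m≥) (ℕ.m⊔n≤o⇒m≤o M N n≥))
    (q m n (ℕ.m⊔n≤o⇒n≤o M N m≥) (ℕ.m⊔n≤o⇒n≤o M N n≥))

-- Finite directed graphs on the vertex set Fin n.  The edge set is given by its
-- characteristic function, so that Edge v u has at most one inhabitant.

record Graph (n : ℕ) : Set where
  V : Set
  V = Fin n
  field
    edge : V → V → Bool
  Edge : V → V → Set
  Edge v u = T (edge v u)
  field
    ω        : ∀ {v u} → Edge v u → ℝ
    ω-nonNeg : ∀ {v u} (e : Edge v u) → 0ℝ ≤ℝ ω e

module _ {n : ℕ} (G : Graph n) where
  open Graph G
  open DecMembership (_≟_ {n}) using (_∈?_)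

  -- ⟨⟩ is the trivial path (s); Π ⊕ e is Π extended by the head of the edge e.
  infixl 5 _⊕_
  data Path (s : V) : V → Set where
    ⟨⟩  : Path s s
    _⊕_ : ∀ {v u} → Path s v → Edge v u → Path s u

  vertices : ∀ {s t} → Path s t → List V
  vertices {s} ⟨⟩            = [ s ]
  vertices (_⊕_ {u = u} Π e) = vertices Π ∷ʳ u

  Simple : ∀ {s t} → Path s t → Set
  Simple P = Unique (vertices P)

  weight : ∀ {s t} → Path s t → ℝ
  weight ⟨⟩      = 0ℝ
  weight (Π ⊕ e) = weight Π +ℝ ω e

  module Exh-S-kSSP (r : V) (k : ℕ) where

    record Entry : Set where
      constructor entry
      field
        {end} : V
        path  : Path r end
        key   : ℝ

    open Entry public

    record State : Set where
      constructor state
      field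
        lists : (v : V) → List (Path r v)
        queue : List Entry

    open State public

    initial : State
    lists initial _ = []
    queue initial   = [ entry ⟨⟩ 0ℝ ]

    extension : ∀ {v} → Path r v → V → Maybe Entry
    extension {v} Π u with T? (edge v u) | u ∈? vertices Π
    ... | yes e | no _  = just (entry (Π ⊕ e) (weight Π +ℝ ω e))
    ... | yes _ | yes _ = nothing
    ... | no _  | _     = nothing

    -- The new entries Π ⊕ (u), for u ∈ N⁺(v) ∖ V(Π).
    extensions : ∀ {v} → Path r v → List Entry
    extensions Π = mapMaybe (extension Π) (allFin n)

    add-if-<k : ∀ {v} → Path r v → ((w : V) → List (Path r w)) → (w : V) → List (Path r w)
    add-if-<k {v} Π L w with v ≟ w
    ... | no _ = L w
    ... | yes refl with length (L v) ℕ.<? k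
    ...   | yes _ = L v ∷ʳ Π
    ...   | no _  = L v

    -- One iteration of the while loop.  The queue is a multiset represented as a
    -- list; any entry of minimum key may be the one dequeued, so ties are broken
    -- arbitrarily.  A state with empty queue is final and is repeated forever.
    data _⟶_ (S : State) : State → Set where
      dequeue : (x : Entry) (x∈ : x ∈ queue S) →
                (∀ y → y ∈ queue S → key x ≤ℝ key y) →
                S ⟶ state (add-if-<k (path x) (lists S))
                          (extensions (path x) ++ (queue S ─ x∈))
      halted  : queue S ≡ [] → S ⟶ S

    Dequeues : ∀ {S S′ t} → S ⟶ S′ → Path r t → Set
    Dequeues {t = t} (dequeue x _ _) P = _≡_ {A = Σ V (Path r)} (end x , path x) (t , P)
    Dequeues         (halted _)      P = ⊥

    -- Termination is not built in: a priori the queue might never become empty.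
    record Execution : Set where
      field
        at    : ℕ → State
        start : at 0 ≡ initial
        step  : ∀ i → at i ⟶ at (suc i)

    open Execution public

{-# OPTIONS --safe #-}

-- Give a queued path that misses f vertices the potential (n + 1) ^ f.  Dequeuing
-- it inserts at most n extensions, each missing fewer vertices, so the total
-- potential of the queue strictly decreases, whichever entry is chosen.  Hence no
-- entry stays queued forever, and every simple path is dequeued by induction on
-- its length: dequeuing Π queues Π ⊕ (u).

module Submission where

open import Defs
open import Data.Bool.Properties using (T?; T-irrelevant)
open import Data.Empty using (⊥-elim)
open import Data.Nat using (ℕ; suc; _+_; _*_; _^_; _≤_; _<_; z≤n)
open import Data.Nat.Induction using (<-wellFounded)
open import Data.Nat.ListAction using (sum)
open import Data.Nat.ListAction.Properties using (sum-++)
open import Data.Nat.Properties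
open import Algebra.Properties.CommutativeSemigroup +-commutativeSemigroup using (x∙yz≈y∙xz)
open import Data.Fin using (Fin)
import Data.Fin.Properties as Fin
open import Data.Fin.Subset as Subset using (Subset; ⊤; _-_; ∣_∣)
open import Data.Fin.Subset.Properties using (∈⊤; x∈p∧x≢y⇒x∈p-y; x∈p⇒∣p-x∣<∣p∣)
open import Data.List using (List; []; _∷_; _++_; _∷ʳ_; map; length; allFin)
open import Data.List.Membership.Propositional using (_∈_; _∉_; lose)
open import Data.List.Membership.Propositional.Properties using (∈-++⁺ˡ; ∈-++⁺ʳ; ∈-allFin)
import Data.List.Membership.DecPropositional as DecMembership
open import Data.List.Properties using (length-mapMaybe; length-tabulate; map-++)
open import Data.List.Relation.Unary.All as All using (All; []; _∷_)
import Data.List.Relation.Unary.All.Properties as All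
open import Data.List.Relation.Unary.Any using (here; there; _─_)
import Data.List.Relation.Unary.Any.Properties as Any
open import Data.List.Relation.Unary.Unique.Propositional using (Unique; []; _∷_)
import Data.Maybe.Relation.Unary.All as Maybe
import Data.Maybe.Relation.Unary.Any as MaybeAny
open import Data.Product using (∃; _×_; _,_)
open import Data.Sum using (_⊎_; inj₁; inj₂)
open import Function using (_∘_; id)
open import Induction.WellFounded using (Acc; acc)
open import Relation.Binary.PropositionalEquality using (_≡_; _≢_; refl; sym; trans; cong; subst)
open import Relation.Nullary using (yes; no)

module _ {A : Set} where

  Unique-∷ʳ⁻ : ∀ (xs : List A) {x} → Unique (xs ∷ʳ x) → Unique xs × x ∉ xs
  Unique-∷ʳ⁻ []       _          = [] , λ ()
  Unique-∷ʳ⁻ (y ∷ xs) (y∉ ∷ uxs) with Unique-∷ʳ⁻ xs uxs | All.∷ʳ⁻ y∉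
  ... | u , x∉xs | y∉xs , y≢x = (y∉xs ∷ u) , λ
    { (here x≡y)   → y≢x (sym x≡y)
    ; (there x∈xs) → x∉xs x∈xs
    }

  -- The two membership proofs are compared as positions, so no decidable equality on elements is
  -- required; queue entries carry real keys and have none to offer.
  ∈-─ : ∀ {x y} {xs : List A} (y∈ : y ∈ xs) → x ∈ xs → y ≡ x ⊎ x ∈ (xs ─ y∈)
  ∈-─ (here refl) (here refl) = inj₁ refl
  ∈-─ (here refl) (there x∈)  = inj₂ x∈
  ∈-─ (there y∈)  (here refl) = inj₂ (here refl)
  ∈-─ (there y∈)  (there x∈)  with ∈-─ y∈ x∈
  ... | inj₁ y≡x = inj₁ y≡x
  ... | inj₂ x∈′ = inj₂ (there x∈′)

  sum-map-─ : ∀ (f : A → ℕ) {y xs} (y∈ : y ∈ xs) →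
              sum (map f xs) ≡ f y + sum (map f (xs ─ y∈))
  sum-map-─ f (here refl)            = refl
  sum-map-─ f {y} {x ∷ _} (there y∈) =
    trans (cong (f x +_) (sum-map-─ f y∈)) (x∙yz≈y∙xz (f x) (f y) _)

  -- Encodes "each term is at most `b / m`" without leaving the naturals; it will be used with
  -- `m = suc n`.
  sum-map-*-≤ : ∀ (f : A → ℕ) {m b xs} → All (λ x → f x * m ≤ b) xs →
                sum (map f xs) * m ≤ length xs * b
  sum-map-*-≤ f []                              = z≤n
  sum-map-*-≤ f {m} {b} {x ∷ xs} (fx*m≤b ∷ fxs) = begin
    (f x + sum (map f xs)) * m    ≡⟨ *-distribʳ-+ m (f x) _ ⟩
    f x * m + sum (map f xs) * m  ≤⟨ +-mono-≤ fx*m≤b (sum-map-*-≤ f fxs) ⟩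
    b + length xs * b             ∎
    where open ≤-Reasoning

module _ {n : ℕ} (G : Graph n) where
  open Graph G
  open DecMembership (Fin._≟_ {n}) using (_∈?_)

  -- Built by recursion on the path, so that one more edge is definitionally one more deletion from
  -- the set.
  unvisited : ∀ {s t} → Path G s t → Subset n
  unvisited {s} ⟨⟩            = ⊤ - s
  unvisited (_⊕_ {u = u} Π e) = unvisited Π - u

  ∉vertices⇒∈unvisited : ∀ {s t u} (Π : Path G s t) → u ∉ vertices G Π → u Subset.∈ unvisited Π
  ∉vertices⇒∈unvisited ⟨⟩      u∉ = x∈p∧x≢y⇒x∈p-y ∈⊤ (u∉ ∘ here)
  ∉vertices⇒∈unvisited (Π ⊕ e) u∉ = x∈p∧x≢y⇒x∈p-y
    (∉vertices⇒∈unvisited Π (u∉ ∘ ∈-++⁺ˡ))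
    (u∉ ∘ ∈-++⁺ʳ (vertices G Π) ∘ here)

  potential : ∀ {s t} → Path G s t → ℕ
  potential Π = suc n ^ ∣ unvisited Π ∣

  potential>0 : ∀ {s t} (Π : Path G s t) → 0 < potential Π
  potential>0 Π = m^n>0 (suc n) ∣ unvisited Π ∣

  -- A new vertex `u` still lies in `unvisited Π`, so deleting it lowers the exponent by at least
  -- one.
  potential-⊕ : ∀ {s v u} (Π : Path G s v) (e : Edge v u) → u ∉ vertices G Π →
                potential (Π ⊕ e) * suc n ≤ potential Π
  potential-⊕ Π e u∉ = begin
    potential (Π ⊕ e) * suc n          ≡⟨ *-comm (potential (Π ⊕ e)) (suc n) ⟩
    -- The strict inequality of cardinalities is by definition the inequality of exponents wanted
    -- here.
    suc n ^ suc ∣ unvisited (Π ⊕ e) ∣  ≤⟨ ^-monoʳ-≤ (suc n) (x∈p⇒∣p-x∣<∣p∣ (∉vertices⇒∈unvisited Π u∉)) ⟩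
    potential Π                        ∎
    where open ≤-Reasoning

  module _ (r : V) (k : ℕ) where
    open Exh-S-kSSP G r k

    queuePotential : List Entry → ℕ
    queuePotential q = sum (map (potential ∘ path) q)

    -- There are at most `n` extensions, each worth at most a fraction 1/(n+1) of `potential Π`.
    -- Both sides are scaled by `suc n`, which is cancelled at the end.
    extensions-potential : ∀ {v} (Π : Path G r v) → queuePotential (extensions Π) < potential Π
    extensions-potential {v} Π = *-cancelʳ-< (suc n) _ _ (begin-strict
      queuePotential (extensions Π) * suc n  ≤⟨ sum-map-*-≤ (potential ∘ path) bounds ⟩
      length (extensions Π) * potential Π    ≤⟨ *-monoˡ-≤ (potential Π) length-extensions ⟩
      -- Strictness enters here: the potential of `Π` is positive, and `suc n * p` unfolds to
      -- `p + n * p`.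
      n * potential Π                        <⟨ m<n+m (n * potential Π) (potential>0 Π) ⟩
      suc n * potential Π                    ≡⟨ *-comm (suc n) (potential Π) ⟩
      potential Π * suc n                    ∎)
      where
      open ≤-Reasoning

      bound : ∀ u → Maybe.All (λ x → potential (path x) * suc n ≤ potential Π) (extension Π u)
      bound u with T? (edge v u) | u ∈? vertices G Π
      ... | yes e | no u∉ = Maybe.just (potential-⊕ Π e u∉)
      ... | yes _ | yes _ = Maybe.nothing
      ... | no _  | _     = Maybe.nothing

      bounds : All (λ x → potential (path x) * suc n ≤ potential Π) (extensions Π)
      bounds = All.mapMaybe⁺ (All.map⁺ (All.universal bound (allFin n)))

      length-extensions : length (extensions Π) ≤ n
      length-extensions = subst (length (extensions Π) ≤_) (length-tabulate id)
                                (length-mapMaybe (extension Π) (allFin n))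

    ∈-extensions : ∀ {v u} (Π : Path G r v) (e : Edge v u) → u ∉ vertices G Π →
                   entry (Π ⊕ e) (weight G Π +ℝ ω e) ∈ extensions Π
    ∈-extensions {v} {u} Π e u∉ =
      Any.mapMaybe⁺ (extension Π) (allFin n) (Any.map⁺ (lose (∈-allFin u) u-extends))
      where
      u-extends : MaybeAny.Any (entry (Π ⊕ e) (weight G Π +ℝ ω e) ≡_) (extension Π u)
      u-extends with T? (edge v u) | u ∈? vertices G Π
      -- The edge proof found by `T?` need not be `e` syntactically, but proofs of `T` are unique.
      ... | yes e′ | no _   = MaybeAny.just (cong (λ d → entry (Π ⊕ d) (weight G Π +ℝ ω d)) (T-irrelevant e e′))
      ... | yes _  | yes u∈ = ⊥-elim (u∉ u∈)
      ... | no ¬e  | _      = ⊥-elim (¬e e)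

    -- If another occurrence `y` leaves the queue, `x` stays behind, and the potential of `y` is
    -- replaced by the strictly smaller total of its extensions.
    dequeued-or-kept : ∀ {S S′ x} (s : S ⟶ S′) → x ∈ queue S →
                       Dequeues s (path x) ⊎
                       (x ∈ queue S′ × queuePotential (queue S′) < queuePotential (queue S))
    -- Halting would mean an empty queue, but `x` is in it.
    dequeued-or-kept (halted q≡[]) x∈ with () ← subst (_ ∈_) q≡[] x∈
    dequeued-or-kept {S} (dequeue y y∈ _) x∈ with ∈-─ y∈ x∈
    ... | inj₁ refl = inj₁ refl
    ... | inj₂ x∈′  = inj₂ (∈-++⁺ʳ (extensions (path y)) x∈′ , (begin-strict
      queuePotential (extensions (path y) ++ rest)                ≡⟨ cong sum (map-++ _ (extensions (path y)) rest) ⟩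
      sum (map _ (extensions (path y)) ++ map _ rest)             ≡⟨ sum-++ (map _ (extensions (path y))) _ ⟩
      queuePotential (extensions (path y)) + queuePotential rest  <⟨ +-monoˡ-< _ (extensions-potential (path y)) ⟩
      potential (path y) + queuePotential rest                    ≡⟨ sum-map-─ (potential ∘ path) y∈ ⟨
      queuePotential (queue S)                                    ∎))
      where
      open ≤-Reasoning
      rest : List Entry
      rest = queue S ─ y∈

    dequeues⇒extension-queued : ∀ {S S′ v u} (s : S ⟶ S′) (Π : Path G r v) (e : Edge v u) →
                                u ∉ vertices G Π → Dequeues s Π →
                                entry (Π ⊕ e) (weight G Π +ℝ ω e) ∈ queue S′
    dequeues⇒extension-queued (dequeue _ _ _) Π e u∉ refl = ∈-++⁺ˡ (∈-extensions Π e u∉)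

    module _ (X : Execution) where

      queued⇒dequeued : ∀ i {x} → x ∈ queue (at X i) → ∃ λ j → Dequeues (step X j) (path x)
      queued⇒dequeued i = go i (<-wellFounded _)
        where
        -- The index `i` varies with the accessibility proof, since each unsuccessful step moves on
        -- to a later state of smaller potential.
        go : ∀ i {x} → Acc _<_ (queuePotential (queue (at X i))) → x ∈ queue (at X i) →
             ∃ λ j → Dequeues (step X j) (path x)
        go i (acc rec) x∈ with dequeued-or-kept (step X i) x∈
        ... | inj₁ dequeued         = i , dequeued
        ... | inj₂ (x∈′ , decrease) = go (suc i) (rec decrease) x∈′

      -- The induction starts at the trivial path, so the endpoint `r` has to be covered as well.
      simple⇒dequeued : ∀ {t} (P : Path G r t) → Simple G P → ∃ λ i → Dequeues (step X i) P
      simple⇒dequeued ⟨⟩ _ =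
        queued⇒dequeued 0 (subst (λ S → entry ⟨⟩ 0ℝ ∈ queue S) (sym (start X)) (here refl))
      simple⇒dequeued (Π ⊕ e) simple with Unique-∷ʳ⁻ (vertices G Π) simple
      ... | Π-simple , u∉ with simple⇒dequeued Π Π-simple
      ...   | i , dequeued =
        -- The step that dequeues `Π` leads from state `i` to state `suc i`, whose queue is the
        -- first known to hold the extension.
        queued⇒dequeued (suc i) (dequeues⇒extension-queued (step X i) Π e u∉ dequeued)

lemma1 : ∀ {n : ℕ} (G : Graph n) (r : Fin n) (k : ℕ) → 1 ≤ k →
    let open Exh-S-kSSP G r k in
    (X : Execution) (t : Fin n) → t ≢ r →
    (P : Path G r t) → Simple G P →
    ∃ λ i → Dequeues (step X i) P
lemma1 G r k _ X _ _ = simple⇒dequeued G r k X
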